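{- For every integer $n\ge 3$, let $\mathcal{B}_n$ be the bipartite graph with partite sets $\{u_0,u_1,\dots,u_n\}$ and $\{v_0,v_1,\dots,v_n\}$ and edge set $$E(\mathcal{B}_n)=\{u_0v_1,u_0v_2,u_0v_3\}\cup\{v_0u_1,v_0u_2,v_0u_3\}\cup\{u_iv_j : i,j\in\{1,\dots,n\}\}.$$ Then $\mathcal{B}_n$ is PMH but not 2FH. Moreover, the vertices $u_0$ and $v_0$ are 3-malleable.
   Context: A $2$-factor of a graph is a $2$-regular spanning subgraph (not necessarily connected), a Hamiltonian cycle is a connected $2$-factor, and a perfect matching is the edge set of a $1$-regular spanning subgraph. A Hamiltonian cycle $H$ extends a perfect matching $M$ if $M\subseteq E(H)$. A graph is 2FH (2-factor Hamiltonian) if it has a Hamiltonian cycle and each of its $2$-factors is a Hamiltonian cycle. A graph admitting a perfect matching is PMH if every one of its perfect matchings can be extended to a Hamiltonian cycle. For a vertex $v$, $\partial v$ denotes the set of edges incident to $v$. If $G$ admits a perfect matching and $v$ is a vertex of degree $t\ge 2$, then $v$ is $t$-malleable if for every perfect matching $M$ of $G$ there exist Hamiltonian cycles $H_1,\dots,H_{t-1}$ of $G$, all extending $M$, such that $\partial v - M\subset \bigcup_{i=1}^{t-1}E(H_i)$. -}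

module Defs where

open import Data.Bool.Base using (Bool; true; false; T)
open import Data.Fin.Base using (Fin; zero; suc; toℕ)
open import Data.Fin.Properties using (+↔⊎)
open import Data.Nat.Base using (ℕ; suc; pred; _+_; _≤_; _≤ᵇ_)
open import Data.Product.Base using (Σ; ∃-syntax; _×_; _,_)
open import Data.Sum.Base using (_⊎_; inj₁; inj₂)
open import Function.Bundles using (_↔_)
open import Function.Construct.Symmetry using (↔-sym)
open import Relation.Binary.Construct.Closure.ReflexiveTransitive using (Star)
open import Relation.Nullary.Negation.Core using (¬_)

-- Finite simple graphs.  Adjacency is Boolean-valued, so that edge sets are
-- decidable and T (adj x y) has at most one inhabitant; in particular
-- ∃[ y ] T (adj x y) is exactly the set of neighbours of x.
record Graph : Set₁ where
  field
    V          : Set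
    finite     : ∃[ k ] (V ↔ Fin k)
    adj        : V → V → Bool
    adj-sym    : ∀ x y → T (adj x y) → T (adj y x)
    adj-irrefl : ∀ x → ¬ T (adj x x)

  Adj : V → V → Set
  Adj x y = T (adj x y)

open Graph

HasDegree : (G : Graph) → V G → ℕ → Set
HasDegree G x k = Fin k ↔ (∃[ y ] Adj G x y)

Regular : ℕ → Graph → Set
Regular k G = ∀ x → HasDegree G x k

Connected : Graph → Set
Connected G = ∀ x y → Star (Adj G) x y

-- A spanning subgraph is determined by its edge set, so this type also
-- serves as the type of subsets of E(G).
record SpanningSubgraph (G : Graph) : Set where
  field
    edge     : V G → V G → Bool
    edge-sym : ∀ x y → T (edge x y) → T (edge y x)
    edge⊆adj : ∀ x y → T (edge x y) → Adj G x y

  Edge : V G → V G → Set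
  Edge x y = T (edge x y)

  graph : Graph
  graph = record
    { V          = V G
    ; finite     = finite G
    ; adj        = edge
    ; adj-sym    = edge-sym
    ; adj-irrefl = λ x e → adj-irrefl G x (edge⊆adj x x e)
    }

open SpanningSubgraph using (Edge; graph)

module _ {G : Graph} where

  IsPerfectMatching : SpanningSubgraph G → Set
  IsPerfectMatching M = Regular 1 (graph M)

  IsTwoFactor : SpanningSubgraph G → Set
  IsTwoFactor F = Regular 2 (graph F)

  IsHamiltonianCycle : SpanningSubgraph G → Set
  IsHamiltonianCycle H = IsTwoFactor H × Connected (graph H)

  _Extends_ : SpanningSubgraph G → SpanningSubgraph G → Set
  H Extends M = ∀ x y → Edge M x y → Edge H x y

AdmitsPerfectMatching : Graph → Set
AdmitsPerfectMatching G = Σ (SpanningSubgraph G) IsPerfectMatching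

2FH : Graph → Set
2FH G =
  (Σ (SpanningSubgraph G) IsHamiltonianCycle) ×
  (∀ (F : SpanningSubgraph G) → IsTwoFactor F → IsHamiltonianCycle F)

PMH : Graph → Set
PMH G =
  AdmitsPerfectMatching G ×
  (∀ (M : SpanningSubgraph G) → IsPerfectMatching M →
    ∃[ H ] (IsHamiltonianCycle H × H Extends M))

-- The cycles H₁ , … , H_{t-1} are indexed by Fin (pred t) and need not be
-- distinct.  An edge of ∂x is given by its endpoint y other than x.
Malleable : (t : ℕ) (G : Graph) → V G → Set
Malleable t G x =
  AdmitsPerfectMatching G ×
  2 ≤ t ×
  HasDegree G x t ×
  (∀ (M : SpanningSubgraph G) → IsPerfectMatching M →
    Σ (Fin (pred t) → SpanningSubgraph G) λ H →
      (∀ i → IsHamiltonianCycle (H i) × H i Extends M) ×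
      (∀ y → Adj G x y → ¬ Edge M x y → ∃[ i ] Edge (H i) x y))

𝓑-Vertex : ℕ → Set
𝓑-Vertex n = Fin (suc n) ⊎ Fin (suc n)

pattern u i = inj₁ i
pattern v j = inj₂ j

-- uv-edge i j decides whether u i and v j are adjacent in 𝓑 n.
uv-edge : ∀ {n} → Fin (suc n) → Fin (suc n) → Bool
uv-edge zero      zero      = false
uv-edge zero      j@(suc _) = toℕ j ≤ᵇ 3
uv-edge i@(suc _) zero      = toℕ i ≤ᵇ 3
uv-edge (suc _)   (suc _)   = true

𝓑-adj : ∀ {n} → 𝓑-Vertex n → 𝓑-Vertex n → Bool
𝓑-adj (u i) (v j) = uv-edge i j
𝓑-adj (v j) (u i) = uv-edge i j
𝓑-adj (u _) (u _) = false
𝓑-adj (v _) (v _) = false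

𝓑 : ℕ → Graph
𝓑 n = record
  { V          = 𝓑-Vertex n
  ; finite     = suc n + suc n , ↔-sym +↔⊎
  ; adj        = 𝓑-adj
  ; adj-sym    = 𝓑-adj-sym
  ; adj-irrefl = 𝓑-adj-irrefl
  }
  where
  𝓑-adj-sym : (x y : 𝓑-Vertex n) → T (𝓑-adj x y) → T (𝓑-adj y x)
  𝓑-adj-sym (u _) (v _) e = e
  𝓑-adj-sym (v _) (u _) e = e

  𝓑-adj-irrefl : (x : 𝓑-Vertex n) → ¬ T (𝓑-adj x x)
  𝓑-adj-irrefl (u _) ()
  𝓑-adj-irrefl (v _) ()

{-# OPTIONS --safe #-}
-- A perfect matching of 𝓑 n is a permutation σ of the indices.  Contracting its
-- edges e i = { u i , v (σ i) }, a Hamiltonian cycle extending it is a cyclic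
-- ordering of the indices in which i may precede j when v (σ i) is adjacent to
-- u j.  Only two steps of such an ordering are constrained: the one from
-- b = σ⁻¹ 0, which must go to some y ∈ {1,2,3}, and the one into 0, which must
-- come from some x with σ x ∈ {1,2,3}.  So whenever 0, b, y, x are distinct,
-- every ordering 0, b, y, …, x works.  The edges of the cycle at u 0 and v 0
-- outside the matching are u 0 – v (σ x) and v 0 – u y; prescribing either of
-- x, y leaves a choice for the other one that makes x ≠ y.
--
-- A disconnected 2-factor consists of the 4-cycle u 0, v 1, u 1, v 2 and a cycle
-- through the remaining vertices.
module Submission where

open import Defs
open import Data.Bool.Base using (Bool; true; false; T)
open import Data.Bool.Properties using (T-irrelevant)
open import Data.Empty using (⊥-elim)
open import Data.Fin.Base using (Fin; zero; suc; toℕ; fromℕ; inject₁; _↑ˡ_; punchIn; punchOut)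
open import Data.Fin.Induction using (<-weakInduction)
open import Data.Fin.Patterns using (0F; 1F; 2F; 3F)
open import Data.Fin.Permutation
  using (Permutation′; permutation; _⟨$⟩ʳ_; _⟨$⟩ˡ_; inverseˡ; inverseʳ; id; flip; _∘ₚ_;
         transpose; insert; swap)
open import Data.Fin.Properties
  using (_≟_; any?; ↑ˡ-injective; suc-injective; punchInᵢ≢i; punchIn-punchOut; toℕ-inject₁)
open import Data.Nat.Base using (ℕ; zero; suc; _+_; _≤_; z≤n; s≤s)
open import Data.Nat.Properties using (1+n≢n)
open import Data.Product.Base using (Σ; ∃-syntax; _×_; _,_; proj₁; proj₂)
open import Data.Sum.Base using (inj₁; inj₂)
open import Data.Sum.Properties using (inj₁-injective; inj₂-injective)
open import Data.Unit.Base using (tt)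
open import Data.Vec.Base using (Vec; []; _∷_; lookup)
open import Data.Vec.Relation.Unary.All using ([]; _∷_)
open import Data.Vec.Relation.Unary.All.Properties using (lookup⁺)
open import Data.Vec.Relation.Unary.AllPairs.Core using ([]; _∷_)
open import Data.Vec.Relation.Unary.Unique.Propositional using (Unique)
open import Function.Base using (_∘_)
open import Function.Bundles using (mk↔ₛ′; Inverse; Injection)
open import Function.Definitions using (Injective)
open import Function.Properties.Inverse using (↔⇒↣)
open import Relation.Binary.Construct.Closure.ReflexiveTransitive
  using (Star; ε; _◅_; _◅◅_; reverse)
open import Relation.Binary.PropositionalEquality
  using (_≡_; _≢_; refl; sym; trans; cong; subst; ≢-sym)
open import Relation.Nullary.Decidable
  using (yes; no; ⌊_⌋; toWitness; fromWitness; dec-true; dec-false)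
open import Relation.Nullary.Negation using (contradiction)
open import Relation.Nullary.Negation.Core using (¬_)

open Graph
open SpanningSubgraph

private
  variable
    k m n : ℕ

-- Permutations

⟨$⟩ʳ-injective : (π : Permutation′ n) → Injective _≡_ _≡_ (π ⟨$⟩ʳ_)
⟨$⟩ʳ-injective π = Injection.injective (↔⇒↣ π)

transpose-source : (i j : Fin n) → transpose i j ⟨$⟩ʳ i ≡ j
transpose-source i j rewrite dec-true (i ≟ i) refl = refl

transpose-fixes : {i j l : Fin n} → l ≢ i → l ≢ j → transpose i j ⟨$⟩ʳ l ≡ l
transpose-fixes {i = i} {j} {l} l≢i l≢j
  rewrite dec-false (l ≟ i) l≢i | dec-false (l ≟ j) l≢j = refl

-- Following a solution for the tails by the transposition of `π x` and `y` corrects the value at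
-- `x`; the tail values equal neither of the two, so they stay. This produces orderings with a few
-- prescribed positions.
extendToPermutation : (xs ys : Vec (Fin n) k) → Unique xs → Unique ys →
  ∃[ π ] (∀ i → π ⟨$⟩ʳ lookup xs i ≡ lookup ys i)
extendToPermutation []       []       []         []         = id , λ ()
extendToPermutation (x ∷ xs) (y ∷ ys) (x∉ ∷ xs!) (y∉ ∷ ys!)
  with π , π-maps ← extendToPermutation xs ys xs! ys! = π ∘ₚ transpose (π ⟨$⟩ʳ x) y , maps
  where
  maps : ∀ i → transpose (π ⟨$⟩ʳ x) y ⟨$⟩ʳ (π ⟨$⟩ʳ lookup (x ∷ xs) i) ≡ lookup (y ∷ ys) i
  maps zero    = transpose-source (π ⟨$⟩ʳ x) y
  maps (suc i) rewrite sym (π-maps i) = transpose-fixes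
    (λ eq → lookup⁺ x∉ i (sym (⟨$⟩ʳ-injective π eq)))
    (λ eq → lookup⁺ y∉ i (trans (sym eq) (π-maps i)))

-- The predecessor modulo `suc n`: `zero` goes to the last index, `suc i` to `inject₁ i`.
rotate : Permutation′ (suc n)
rotate {n} = insert zero (fromℕ n) id

punchIn-fromℕ : (i : Fin n) → punchIn (fromℕ n) i ≡ inject₁ i
punchIn-fromℕ zero    = refl
punchIn-fromℕ (suc i) = cong suc (punchIn-fromℕ i)

rotate-suc : (i : Fin n) → rotate ⟨$⟩ʳ suc i ≡ inject₁ i
rotate-suc = punchIn-fromℕ

rotate-≢ : (i : Fin (2 + n)) → rotate ⟨$⟩ʳ i ≢ i
rotate-≢ zero    ()
rotate-≢ (suc i) eq = 1+n≢n (trans (cong toℕ (sym (trans (sym (rotate-suc i)) eq))) (toℕ-inject₁ i))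

-- Degrees and perfect matchings

neighbour-≡ : (G : Graph) {x : V G} {p q : ∃[ y ] Adj G x y} → proj₁ p ≡ proj₁ q → p ≡ q
neighbour-≡ G refl = cong (_ ,_) (T-irrelevant _ _)

enumerateNeighbours : (G : Graph) (x : V G) (f : Fin k → V G) → Injective _≡_ _≡_ f →
  (∀ i → Adj G x (f i)) → (∀ y → Adj G x y → ∃[ i ] f i ≡ y) → HasDegree G x k
enumerateNeighbours G x f f-inj f-adj f-covers = mk↔ₛ′
  (λ i → f i , f-adj i)
  (λ (y , e) → proj₁ (f-covers y e))
  (λ (y , e) → neighbour-≡ G (proj₂ (f-covers y e)))
  (λ i → f-inj (proj₂ (f-covers (f i) (f-adj i))))

module _ {G : Graph} (M : SpanningSubgraph G) (pm : IsPerfectMatching M) where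

  mate : ∀ x → ∃[ y ] Edge M x y
  mate x = Inverse.to (pm x) zero

  mate-unique : ∀ {x y z} → Edge M x y → Edge M x z → y ≡ z
  mate-unique {x} {y} {z} d e = cong proj₁ (trans (to-zero (y , d)) (sym (to-zero (z , e))))
    where
    to-zero : ∀ w → w ≡ mate x
    to-zero w with Inverse.from (pm x) w in eq
    ... | zero = sym (Inverse.inverseˡ (pm x) (sym eq))

-- One cycle per unmatched edge at `x` suffices: `c` is the index of the matching edge, and
-- `punchIn c` enumerates the `k` others.
malleable : (G : Graph) (x : V G) → AdmitsPerfectMatching G → 1 ≤ k → HasDegree G x (suc k) →
  (∀ (M : SpanningSubgraph G) → IsPerfectMatching M → ∀ y → Adj G x y → ¬ Edge M x y →
    ∃[ H ] ((IsHamiltonianCycle H × H Extends M) × Edge H x y)) →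
  Malleable (suc k) G x
malleable {k} G x pmG 1≤k deg cycleThrough = pmG , s≤s 1≤k , deg , cycles
  where
  cycles : ∀ (M : SpanningSubgraph G) → IsPerfectMatching M →
    Σ (Fin k → SpanningSubgraph G) λ H →
      (∀ i → IsHamiltonianCycle (H i) × H i Extends M) ×
      (∀ y → Adj G x y → ¬ Edge M x y → ∃[ i ] Edge (H i) x y)
  cycles M pm = (λ i → proj₁ (cycle i)) , (λ i → proj₁ (proj₂ (cycle i))) , covers
    where
    open Inverse deg

    matched : ∃[ y ] Adj G x y
    matched = proj₁ (mate M pm x) , edge⊆adj M x _ (proj₂ (mate M pm x))

    c : Fin (suc k)
    c = from matched

    unmatched : ∀ i → ¬ Edge M x (proj₁ (to (punchIn c i)))
    unmatched i e = punchInᵢ≢i c i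
      (trans (sym (strictlyInverseʳ _)) (cong from (neighbour-≡ G (mate-unique M pm e (proj₂ (mate M pm x))))))

    cycle : ∀ i → ∃[ H ] ((IsHamiltonianCycle H × H Extends M) × Edge H x (proj₁ (to (punchIn c i))))
    cycle i = cycleThrough M pm _ (proj₂ (to (punchIn c i))) (unmatched i)

    covers : ∀ y → Adj G x y → ¬ Edge M x y → ∃[ i ] Edge (proj₁ (cycle i)) x y
    covers y e ¬m = punchOut c≢ , subst (Edge (proj₁ (cycle _)) x) to≡y (proj₂ (proj₂ (cycle (punchOut c≢))))
      where
      c≢ : c ≢ from (y , e)
      c≢ eq = ¬m (subst (Edge M x)
        (cong proj₁ (trans (sym (strictlyInverseˡ matched)) (trans (cong to eq) (strictlyInverseˡ (y , e)))))
        (proj₂ (mate M pm x)))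

      to≡y : proj₁ (to (punchIn c (punchOut c≢))) ≡ y
      to≡y = cong proj₁ (trans (cong to (punchIn-punchOut c≢)) (strictlyInverseˡ (y , e)))

-- Spanning subgraphs of 𝓑 n as unions of pairwise disjoint permutations

Allowed : Permutation′ (suc n) → Set
Allowed σ = ∀ i → T (uv-edge i (σ ⟨$⟩ʳ i))

module _ (P : Fin k → Permutation′ (suc n)) (allowed : ∀ c → Allowed (P c)) where

  unionEdge : 𝓑-Vertex n → 𝓑-Vertex n → Bool
  unionEdge (u i) (v j) = ⌊ any? (λ c → P c ⟨$⟩ʳ i ≟ j) ⌋
  unionEdge (v j) (u i) = ⌊ any? (λ c → P c ⟨$⟩ʳ i ≟ j) ⌋
  unionEdge (u _) (u _) = false
  unionEdge (v _) (v _) = false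

  unionEdge-permutation : ∀ i j → T (unionEdge (u i) (v j)) → ∃[ c ] P c ⟨$⟩ʳ i ≡ j
  unionEdge-permutation i j = toWitness

  unionEdge⊆uv-edge : ∀ i j → T (unionEdge (u i) (v j)) → T (uv-edge i j)
  unionEdge⊆uv-edge i j e with c , refl ← unionEdge-permutation i j e = allowed c i

  union : SpanningSubgraph (𝓑 n)
  union .edge = unionEdge
  union .edge-sym (u _) (v _) e = e
  union .edge-sym (v _) (u _) e = e
  union .edge⊆adj (u i) (v j) e = unionEdge⊆uv-edge i j e
  union .edge⊆adj (v j) (u i) e = unionEdge⊆uv-edge i j e

  union-edge : ∀ c i {j} → P c ⟨$⟩ʳ i ≡ j → T (unionEdge (u i) (v j))
  union-edge c i eq = fromWitness (c , eq)

  -- Disjointness is assumed on the `u` side; it carries over to `v j`, because `P c` and `P d` with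
  -- the same preimage of `j` agree at that preimage.
  union-regular : (∀ i → Injective _≡_ _≡_ (λ c → P c ⟨$⟩ʳ i)) → Regular k (graph union)
  union-regular disjoint (u i) = enumerateNeighbours (graph union) (u i) (λ c → v (P c ⟨$⟩ʳ i))
    (disjoint i ∘ inj₂-injective)
    (λ c → union-edge c _ refl)
    λ where (v j) e → let c , eq = unionEdge-permutation _ _ e in c , cong inj₂ eq
  union-regular disjoint (v j) = enumerateNeighbours (graph union) (v j) (λ c → u (P c ⟨$⟩ˡ j))
    (λ {c} {d} eq → disjoint _ (trans (inverseʳ (P c))
      (sym (trans (cong (P d ⟨$⟩ʳ_) (inj₁-injective eq)) (inverseʳ (P d))))))
    (λ c → union-edge c _ (inverseʳ (P c)))
    λ where (u i) e → let c , eq = unionEdge-permutation _ _ e in c , cong inj₁ (trans (cong (P c ⟨$⟩ˡ_) (sym eq)) (inverseˡ (P c)))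

pair : Permutation′ n → Permutation′ n → Fin 2 → Permutation′ n
pair σ τ 0F = σ
pair σ τ 1F = τ

module _ (σ τ : Permutation′ (suc n)) (σ-allowed : Allowed σ) (τ-allowed : Allowed τ)
  (σ≢τ : ∀ i → σ ⟨$⟩ʳ i ≢ τ ⟨$⟩ʳ i) where

  private
    pair-allowed : ∀ c → Allowed (pair σ τ c)
    pair-allowed 0F = σ-allowed
    pair-allowed 1F = τ-allowed

  union₂ : SpanningSubgraph (𝓑 n)
  union₂ = union (pair σ τ) pair-allowed

  union₂-isTwoFactor : IsTwoFactor union₂
  union₂-isTwoFactor = union-regular (pair σ τ) pair-allowed disjoint
    where
    disjoint : ∀ i → Injective _≡_ _≡_ (λ c → pair σ τ c ⟨$⟩ʳ i)
    disjoint i {0F} {0F} _  = refl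
    disjoint i {0F} {1F} eq = contradiction eq (σ≢τ i)
    disjoint i {1F} {0F} eq = contradiction (sym eq) (σ≢τ i)
    disjoint i {1F} {1F} _  = refl

  union₂-edge : ∀ c i {j} → pair σ τ c ⟨$⟩ʳ i ≡ j → Edge union₂ (u i) (v j)
  union₂-edge = union-edge (pair σ τ) pair-allowed

  union₂-permutation : ∀ i j → Edge union₂ (u i) (v j) → ∃[ c ] pair σ τ c ⟨$⟩ʳ i ≡ j
  union₂-permutation = unionEdge-permutation (pair σ τ) pair-allowed

-- Hamiltonian cycles

-- π lists the indices in the cyclic order in which the cycle visits the
-- matching edges u i – v (σ i).
cyclicPartner : (σ π : Permutation′ (suc n)) → Permutation′ (suc n)
cyclicPartner σ π = flip π ∘ₚ rotate ∘ₚ π ∘ₚ σ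

-- Equality would make the position of `i` in the list a fixed point of `rotate`.
cyclicPartner-≢ : (σ π : Permutation′ (2 + n)) (i : Fin (2 + n)) →
  σ ⟨$⟩ʳ i ≢ cyclicPartner σ π ⟨$⟩ʳ i
cyclicPartner-≢ σ π i eq = rotate-≢ (π ⟨$⟩ˡ i)
  (trans (sym (inverseˡ π)) (cong (π ⟨$⟩ˡ_) (sym (⟨$⟩ʳ-injective σ eq))))

-- The partner joins `u i` to the `v` end of the matching edge listed just before `i`; for the head
-- of the list that is the last one.
cyclicPartner-zero : (σ π : Permutation′ (suc n)) →
  cyclicPartner σ π ⟨$⟩ʳ (π ⟨$⟩ʳ zero) ≡ σ ⟨$⟩ʳ (π ⟨$⟩ʳ fromℕ n)
cyclicPartner-zero σ π = cong (λ l → σ ⟨$⟩ʳ (π ⟨$⟩ʳ (rotate ⟨$⟩ʳ l))) (inverseˡ π)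

cyclicPartner-suc : (σ π : Permutation′ (suc n)) (k : Fin n) →
  cyclicPartner σ π ⟨$⟩ʳ (π ⟨$⟩ʳ suc k) ≡ σ ⟨$⟩ʳ (π ⟨$⟩ʳ inject₁ k)
cyclicPartner-suc σ π k = cong ((σ ⟨$⟩ʳ_) ∘ (π ⟨$⟩ʳ_))
  (trans (cong (rotate ⟨$⟩ʳ_) (inverseˡ π)) (rotate-suc k))

module _ (σ π : Permutation′ (2 + n)) (σ-allowed : Allowed σ)
  (τ-allowed : Allowed (cyclicPartner σ π)) where

  private
    H : SpanningSubgraph (𝓑 (suc n))
    H = union₂ σ (cyclicPartner σ π) σ-allowed τ-allowed (cyclicPartner-≢ σ π)

    H-edge = union₂-edge σ (cyclicPartner σ π) σ-allowed τ-allowed (cyclicPartner-≢ σ π)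

    start : V (𝓑 (suc n))
    start = u (π ⟨$⟩ʳ zero)

    reach-u : ∀ k → Star (Edge H) start (u (π ⟨$⟩ʳ k))
    reach-u = <-weakInduction _ ε step
      where
      step : ∀ k → Star (Edge H) start (u (π ⟨$⟩ʳ inject₁ k)) → Star (Edge H) start (u (π ⟨$⟩ʳ suc k))
      -- A matching edge leads to the `v` side and a partner edge back; `unionEdge` computes to the
      -- same value in both directions.
      step k p = p ◅◅ _◅_ {j = v (σ ⟨$⟩ʳ (π ⟨$⟩ʳ inject₁ k))}
        (H-edge 0F (π ⟨$⟩ʳ inject₁ k) refl)
        (H-edge 1F (π ⟨$⟩ʳ suc k) (cyclicPartner-suc σ π k) ◅ ε)

    reach : ∀ x → Star (Edge H) start x
    reach (u i) = subst (λ l → Star (Edge H) start (u l)) (inverseʳ π) (reach-u (π ⟨$⟩ˡ i))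
    reach (v j) = reach (u (σ ⟨$⟩ˡ j)) ◅◅ H-edge 0F (σ ⟨$⟩ˡ j) (inverseʳ σ) ◅ ε

  cyclic-isHamiltonianCycle : IsHamiltonianCycle H
  cyclic-isHamiltonianCycle =
    union₂-isTwoFactor σ (cyclicPartner σ π) σ-allowed τ-allowed (cyclicPartner-≢ σ π) ,
    λ x y → reverse (λ {x} {y} → edge-sym H x y) (reach x) ◅◅ reach y

-- With both indices positive the edge is always present, so a permutation need only be checked at
-- `zero` and at the preimage of `zero`.
uv-edge-except-0 : (i j : Fin (suc n)) →
  (i ≡ zero → T (uv-edge i j)) → (j ≡ zero → T (uv-edge i j)) → T (uv-edge i j)
uv-edge-except-0 zero    j       at-i at-j = at-i refl
uv-edge-except-0 (suc i) zero    at-i at-j = at-j refl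
uv-edge-except-0 (suc i) (suc j) at-i at-j = tt

module _ (σ π : Permutation′ (4 + m)) (σ-allowed : Allowed σ) {y z : Fin (4 + m)}
  (z∼u₀ : T (uv-edge zero z)) (y∼v₀ : T (uv-edge y zero))
  (π0 : π ⟨$⟩ʳ 0F ≡ zero) (π1 : π ⟨$⟩ʳ 1F ≡ σ ⟨$⟩ˡ zero)
  (π2 : π ⟨$⟩ʳ 2F ≡ y) (πlast : π ⟨$⟩ʳ fromℕ (3 + m) ≡ σ ⟨$⟩ˡ z) where

  private
    τ : Permutation′ (4 + m)
    τ = cyclicPartner σ π

    -- Read cyclically, the list has σ⁻¹ z just before 0, and `y` just after σ⁻¹ 0. These two steps
    -- give the partner edges at `u zero` and `v zero`.
    τ0≡z : τ ⟨$⟩ʳ zero ≡ z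
    τ0≡z = trans (cong (τ ⟨$⟩ʳ_) (sym π0))
      (trans (cyclicPartner-zero σ π) (trans (cong (σ ⟨$⟩ʳ_) πlast) (inverseʳ σ)))

    τy≡0 : τ ⟨$⟩ʳ y ≡ zero
    τy≡0 = trans (cong (τ ⟨$⟩ʳ_) (sym π2))
      (trans (cyclicPartner-suc σ π 1F) (trans (cong (σ ⟨$⟩ʳ_) π1) (inverseʳ σ)))

    τ-allowed : Allowed τ
    τ-allowed i = uv-edge-except-0 i (τ ⟨$⟩ʳ i)
      (λ i≡0 → subst (λ l → T (uv-edge l (τ ⟨$⟩ʳ l))) (sym i≡0)
        (subst (λ j → T (uv-edge zero j)) (sym τ0≡z) z∼u₀))
      (λ τi≡0 → subst (λ j → T (uv-edge i j)) (sym τi≡0)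
        (subst (λ l → T (uv-edge l zero)) (⟨$⟩ʳ-injective τ (trans τy≡0 (sym τi≡0))) y∼v₀))

    H-edge = union₂-edge σ τ σ-allowed τ-allowed (cyclicPartner-≢ σ π)

  extendMatchingAlong :
    ∃[ H ] (IsHamiltonianCycle {𝓑 (3 + m)} H × (∀ i → Edge H (u i) (v (σ ⟨$⟩ʳ i))) ×
      Edge H (u zero) (v z) × Edge H (v zero) (u y))
  extendMatchingAlong = union₂ σ τ σ-allowed τ-allowed (cyclicPartner-≢ σ π) ,
    cyclic-isHamiltonianCycle σ π σ-allowed τ-allowed ,
    (λ i → H-edge 0F i refl) , H-edge 1F zero τ0≡z , H-edge 1F y τy≡0

-- The assumed inequalities say that `x` differs from 0, and `y` from `b` and `x`. The rest of the
-- distinctness of 0, `b`, `y`, `x` follows from `u zero` and `v zero` not being adjacent.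
extendMatching : (σ : Permutation′ (4 + m)) → Allowed σ → ∀ y z →
  T (uv-edge zero z) → z ≢ σ ⟨$⟩ʳ zero →
  T (uv-edge y zero) → σ ⟨$⟩ʳ y ≢ zero → σ ⟨$⟩ʳ y ≢ z →
  ∃[ H ] (IsHamiltonianCycle {𝓑 (3 + m)} H × (∀ i → Edge H (u i) (v (σ ⟨$⟩ʳ i))) ×
    Edge H (u zero) (v z) × Edge H (v zero) (u y))
extendMatching {m} σ σ-allowed y z z∼u₀ z≢σ0 y∼v₀ σy≢0 σy≢z =
  let π , π-maps = ordering
  in extendMatchingAlong σ π σ-allowed z∼u₀ y∼v₀ (π-maps 0F) (π-maps 1F) (π-maps 2F) (π-maps 3F)
  where
  x b : Fin (4 + m)
  x = σ ⟨$⟩ˡ z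
  b = σ ⟨$⟩ˡ zero

  σ-from : ∀ {i j} → σ ⟨$⟩ˡ j ≡ i → σ ⟨$⟩ʳ i ≡ j
  σ-from eq = trans (cong (σ ⟨$⟩ʳ_) (sym eq)) (inverseʳ σ)

  0≢b : zero ≢ b
  -- The result lies in `T (uv-edge zero zero)`, which is empty; `b≢x` ends the same way.
  0≢b eq = subst (λ j → T (uv-edge zero j)) (σ-from (sym eq)) (σ-allowed zero)

  0≢y : zero ≢ y
  0≢y refl = y∼v₀

  b≢x : b ≢ x
  b≢x eq = subst (λ j → T (uv-edge zero j)) (trans (sym (inverseʳ σ)) (σ-from eq)) z∼u₀

  ordering : ∃[ π ] (∀ i → π ⟨$⟩ʳ lookup (0F ∷ 1F ∷ 2F ∷ fromℕ (3 + m) ∷ []) i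
                           ≡ lookup (zero ∷ b ∷ y ∷ x ∷ []) i)
  ordering = extendToPermutation _ _
    -- The positions 0, 1, 2 and 3 + m are distinct because there are at least four indices.
    (((λ ()) ∷ (λ ()) ∷ (λ ()) ∷ []) ∷ ((λ ()) ∷ (λ ()) ∷ []) ∷ ((λ ()) ∷ []) ∷ [] ∷ [])
    ((0≢b ∷ 0≢y ∷ (λ eq → z≢σ0 (sym (σ-from (sym eq)))) ∷ []) ∷
     ((λ eq → σy≢0 (σ-from eq)) ∷ b≢x ∷ []) ∷
     ((λ eq → σy≢z (σ-from (sym eq))) ∷ []) ∷ [] ∷ [])

-- Perfect matchings of 𝓑 n as permutations

module _ (M : SpanningSubgraph (𝓑 n)) (pm : IsPerfectMatching M) where

  private
    mate-u : ∀ i → ∃[ j ] Edge M (u i) (v j)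
    mate-u i with mate M pm (u i)
    ... | u j , e = ⊥-elim (edge⊆adj M (u i) (u j) e)
    ... | v j , e = j , e

    mate-v : ∀ j → ∃[ i ] Edge M (v j) (u i)
    mate-v j with mate M pm (v j)
    ... | u i , e = i , e
    ... | v i , e = ⊥-elim (edge⊆adj M (v j) (v i) e)

  matchingPermutation : Permutation′ (suc n)
  matchingPermutation = permutation (proj₁ ∘ mate-u) (proj₁ ∘ mate-v)
    (λ j → inj₂-injective (mate-unique M pm (proj₂ (mate-u _)) (edge-sym M _ _ (proj₂ (mate-v j)))))
    (λ i → inj₁-injective (mate-unique M pm (proj₂ (mate-v _)) (edge-sym M _ _ (proj₂ (mate-u i)))))

  matchingPermutation-edge : ∀ {i j} → matchingPermutation ⟨$⟩ʳ i ≡ j → Edge M (u i) (v j)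
  matchingPermutation-edge {i} refl = proj₂ (mate-u i)

  edge-matchingPermutation : ∀ {i j} → Edge M (u i) (v j) → matchingPermutation ⟨$⟩ʳ i ≡ j
  edge-matchingPermutation {i} e = inj₂-injective (mate-unique M pm (proj₂ (mate-u i)) e)

  matchingPermutation-allowed : Allowed matchingPermutation
  matchingPermutation-allowed i = edge⊆adj M _ _ (proj₂ (mate-u i))

  extends : (H : SpanningSubgraph (𝓑 n)) →
    (∀ i → Edge H (u i) (v (matchingPermutation ⟨$⟩ʳ i))) → H Extends M
  extends H H-edge (u i) (v j) e =
    subst (λ l → Edge H (u i) (v l)) (edge-matchingPermutation e) (H-edge i)
  extends H H-edge (v j) (u i) e =
    edge-sym H (u i) (v j) (extends H H-edge (u i) (v j) (edge-sym M (v j) (u i) e))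
  extends H H-edge (u i) (u j) e = ⊥-elim (edge⊆adj M (u i) (u j) e)
  extends H H-edge (v i) (v j) e = ⊥-elim (edge⊆adj M (v i) (v j) e)

-- Each of 1, 2, 3 is the index of a neighbour of both `u zero` and `v zero`, so two exclusions
-- leave a choice; 3 is taken only when `p` and `q` are 1 and 2 in some order.
neighbourAvoiding : (p q : Fin (4 + m)) →
  ∃[ r ] (T (uv-edge zero r) × T (uv-edge r zero) × r ≢ p × r ≢ q)
neighbourAvoiding p q with 1F ≟ p | 1F ≟ q | 2F ≟ p | 2F ≟ q
... | no 1≢p   | no 1≢q   | _        | _        = 1F , tt , tt , 1≢p , 1≢q
... | yes refl | _        | _        | no 2≢q   = 2F , tt , tt , (λ ()) , 2≢q
... | yes refl | _        | _        | yes refl = 3F , tt , tt , (λ ()) , (λ ())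
... | no _     | yes refl | no 2≢p   | _        = 2F , tt , tt , 2≢p , (λ ())
... | no _     | yes refl | yes refl | _        = 3F , tt , tt , (λ ()) , (λ ())

module _ (M : SpanningSubgraph (𝓑 (3 + m))) (pm : IsPerfectMatching M) where

  private
    σ : Permutation′ (4 + m)
    σ = matchingPermutation M pm

  -- With `z` fixed, the second index has to avoid σ⁻¹ 0 and σ⁻¹ z.
  cycleThrough-u₀ : ∀ y → Adj (𝓑 (3 + m)) (u zero) y → ¬ Edge M (u zero) y →
    ∃[ H ] ((IsHamiltonianCycle H × H Extends M) × Edge H (u zero) y)
  cycleThrough-u₀ (v z) z∼u₀ unmatched =
    let y , _ , y∼v₀ , y≢b , y≢x = neighbourAvoiding (σ ⟨$⟩ˡ zero) (σ ⟨$⟩ˡ z)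
        H , ham , H⊇σ , H∋z , _ = extendMatching σ (matchingPermutation-allowed M pm) y z
          z∼u₀ (λ eq → unmatched (matchingPermutation-edge M pm (sym eq))) y∼v₀
          (λ eq → y≢b (trans (sym (inverseˡ σ)) (cong (σ ⟨$⟩ˡ_) eq)))
          (λ eq → y≢x (trans (sym (inverseˡ σ)) (cong (σ ⟨$⟩ˡ_) eq)))
    in H , (ham , extends M pm H H⊇σ) , H∋z

  -- With `y` fixed, `z` has to avoid σ 0 and σ y.
  cycleThrough-v₀ : ∀ x → Adj (𝓑 (3 + m)) (v zero) x → ¬ Edge M (v zero) x →
    ∃[ H ] ((IsHamiltonianCycle H × H Extends M) × Edge H (v zero) x)
  cycleThrough-v₀ (u y) y∼v₀ unmatched =
    let z , z∼u₀ , _ , z≢σ0 , z≢σy = neighbourAvoiding (σ ⟨$⟩ʳ zero) (σ ⟨$⟩ʳ y)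
        H , ham , H⊇σ , _ , H∋y = extendMatching σ (matchingPermutation-allowed M pm) y z
          z∼u₀ z≢σ0 y∼v₀
          (λ eq → unmatched (edge-sym M _ _ (matchingPermutation-edge M pm eq)))
          (≢-sym z≢σy)
    in H , (ham , extends M pm H H⊇σ) , H∋y

-- A perfect matching and a disconnected 2-factor

-- The identity would use the missing edge `u 0F` - `v 0F`. Unlike the transposition of 0 and 1, the
-- 3-cycle gives `u 0F` and `u 1F` the partners `v 1F` and `v 2F`, which can be exchanged to form
-- the square.
cycle₀₁₂ : Permutation′ (3 + m)
cycle₀₁₂ = permutation to from
  (λ { 0F → refl ; 1F → refl ; 2F → refl ; (suc (suc (suc _))) → refl })
  (λ { 0F → refl ; 1F → refl ; 2F → refl ; (suc (suc (suc _))) → refl })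
  where
  to from : Fin (3 + m) → Fin (3 + m)
  to 0F = 1F
  to 1F = 2F
  to 2F = 0F
  to i  = i
  from 0F = 2F
  from 1F = 0F
  from 2F = 1F
  from i  = i

cycle₀₁₂-allowed : Allowed (cycle₀₁₂ {suc m})
cycle₀₁₂-allowed 0F                  = tt
cycle₀₁₂-allowed 1F                  = tt
cycle₀₁₂-allowed 2F                  = tt
cycle₀₁₂-allowed (suc (suc (suc _))) = tt

admitsPerfectMatching : AdmitsPerfectMatching (𝓑 (3 + m))
admitsPerfectMatching =
  union {k = 1} (λ _ → cycle₀₁₂) (λ _ → cycle₀₁₂-allowed) ,
  union-regular {k = 1} (λ _ → cycle₀₁₂) (λ _ → cycle₀₁₂-allowed) λ { _ {0F} {0F} _ → refl }

-- `swap` exchanges 0 and 1 and lets `rotate` act on the other indices, of which there are at least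
-- two.
swap-rotate-≢ : (i : Fin (4 + m)) → swap rotate ⟨$⟩ʳ i ≢ i
swap-rotate-≢ 0F            ()
swap-rotate-≢ 1F            ()
swap-rotate-≢ (suc (suc i)) eq = rotate-≢ i (suc-injective (suc-injective eq))

module _ {m : ℕ} where

  private
    σ τ : Permutation′ (4 + m)
    σ = cycle₀₁₂
    τ = swap rotate ∘ₚ cycle₀₁₂

    τ-allowed : Allowed τ
    -- Index 0 goes to 2, and index 3 goes to 0, along the edge `u 3F` - `v 0F`; all other edges
    -- have both indices positive.
    τ-allowed 0F                        = tt
    τ-allowed 1F                        = tt
    τ-allowed 2F                        = tt
    τ-allowed 3F                        = tt
    τ-allowed (suc (suc (suc (suc i)))) = tt

    σ≢τ : ∀ i → σ ⟨$⟩ʳ i ≢ τ ⟨$⟩ʳ i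
    σ≢τ i eq = swap-rotate-≢ i (sym (⟨$⟩ʳ-injective σ eq))

    F : SpanningSubgraph (𝓑 (3 + m))
    F = union₂ σ τ cycle₀₁₂-allowed τ-allowed σ≢τ

    isBelow2 : Fin (4 + m) → Bool
    isBelow2 0F = true
    isBelow2 1F = true
    isBelow2 _  = false

    -- A colouring constant on the edges of `F`: `v j` takes the colour of its `σ`-mate, and
    -- `swap rotate` preserves the set of 0 and 1, so the edges of `τ` respect it too.
    inSquare : 𝓑-Vertex (3 + m) → Bool
    inSquare (u i) = isBelow2 i
    inSquare (v j) = isBelow2 (σ ⟨$⟩ˡ j)

    swap-rotate-isBelow2 : ∀ i → isBelow2 (swap rotate ⟨$⟩ʳ i) ≡ isBelow2 i
    swap-rotate-isBelow2 0F            = refl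
    swap-rotate-isBelow2 1F            = refl
    swap-rotate-isBelow2 (suc (suc i)) = refl

    σ-inSquare : ∀ i → inSquare (v (σ ⟨$⟩ʳ i)) ≡ isBelow2 i
    σ-inSquare i = cong isBelow2 (inverseˡ σ)

    pair-inSquare : ∀ c i → inSquare (v (pair σ τ c ⟨$⟩ʳ i)) ≡ inSquare (u i)
    pair-inSquare 0F i = σ-inSquare i
    pair-inSquare 1F i = trans (σ-inSquare (swap rotate ⟨$⟩ʳ i)) (swap-rotate-isBelow2 i)

    uv-inSquare : ∀ i j → Edge F (u i) (v j) → inSquare (u i) ≡ inSquare (v j)
    uv-inSquare i j e =
      let c , eq = union₂-permutation σ τ cycle₀₁₂-allowed τ-allowed σ≢τ i j e
      in trans (sym (pair-inSquare c i)) (cong (λ l → inSquare (v l)) eq)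

    edge-inSquare : ∀ x y → Edge F x y → inSquare x ≡ inSquare y
    edge-inSquare (u i) (v j) e = uv-inSquare i j e
    edge-inSquare (v j) (u i) e = sym (uv-inSquare i j e)

    path-inSquare : ∀ {x y} → Star (Edge F) x y → inSquare x ≡ inSquare y
    path-inSquare ε                     = refl
    path-inSquare {x} (_◅_ {j = w} e p) = trans (edge-inSquare x w e) (path-inSquare p)

  ¬2FH-𝓑 : ¬ 2FH (𝓑 (3 + m))
  ¬2FH-𝓑 (_ , allHamiltonian)
    -- `u zero` is in the square, while `v zero`, the `σ`-mate of `u 2F`, is not; a path would give
    -- `true ≡ false`.
    with () ← path-inSquare {u zero} {v zero}
      (proj₂ (allHamiltonian F (union₂-isTwoFactor σ τ cycle₀₁₂-allowed τ-allowed σ≢τ)) (u zero) (v zero))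

-- Degrees of the two special vertices, and the conclusion

firstThree : Fin 3 → Fin (4 + m)
firstThree {m} i = suc (i ↑ˡ m)

firstThree-injective : Injective _≡_ _≡_ (firstThree {m})
firstThree-injective {m} eq = ↑ˡ-injective m _ _ (suc-injective eq)

degree-u₀ : HasDegree (𝓑 (3 + m)) (u zero) 3
degree-u₀ = enumerateNeighbours (𝓑 _) (u zero) (λ i → v (firstThree i))
  (firstThree-injective ∘ inj₂-injective)
  (λ { 0F → tt ; 1F → tt ; 2F → tt })
  (λ { (v 1F) _ → 0F , refl ; (v 2F) _ → 1F , refl ; (v 3F) _ → 2F , refl })

degree-v₀ : HasDegree (𝓑 (3 + m)) (v zero) 3
degree-v₀ = enumerateNeighbours (𝓑 _) (v zero) (λ i → u (firstThree i))
  (firstThree-injective ∘ inj₁-injective)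
  (λ { 0F → tt ; 1F → tt ; 2F → tt })
  (λ { (u 1F) _ → 0F , refl ; (u 2F) _ → 1F , refl ; (u 3F) _ → 2F , refl })

PMH-𝓑 : PMH (𝓑 (3 + m))
PMH-𝓑 = admitsPerfectMatching , λ M pm →
  let σ = matchingPermutation M pm
      -- A cycle through any unmatched edge at `u zero` will do; the second index to avoid is an
      -- arbitrary filler.
      z , z∼u₀ , _ , z≢σ0 , _ = neighbourAvoiding (σ ⟨$⟩ʳ zero) zero
      H , hamExt , _ = cycleThrough-u₀ M pm (v z) z∼u₀ (z≢σ0 ∘ sym ∘ edge-matchingPermutation M pm)
  in H , hamExt

proposition2p7 : (n : ℕ) → 3 ≤ n →
    PMH (𝓑 n) × ¬ 2FH (𝓑 n) × Malleable 3 (𝓑 n) (u zero) × Malleable 3 (𝓑 n) (v zero)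
proposition2p7 _ (s≤s (s≤s (s≤s z≤n))) =
  PMH-𝓑 ,
  ¬2FH-𝓑 ,
  malleable (𝓑 _) (u zero) admitsPerfectMatching (s≤s z≤n) degree-u₀ cycleThrough-u₀ ,
  malleable (𝓑 _) (v zero) admitsPerfectMatching (s≤s z≤n) degree-v₀ cycleThrough-v₀
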